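{- Let $\mathcal{B}$ be a swap structure for $\mathbf{mbCciw}$. Then there exist a set $I$ and a monomorphism of multialgebras $\hat h:\mathcal{B}\to\prod_{i\in I}\mathcal{B}_{\mathbb{A}_2}^{\mathbf{mbCciw}}$.
   Context: Let $\Sigma=\{\wedge,\vee,\to,\neg,\circ\}$, with $\wedge,\vee,\to$ binary and $\neg,\circ$ unary. A multialgebra over $\Sigma$ is a nonempty set $B$ with, for each $n$-ary symbol $c$, a function $c^{\mathcal{B}}:B^n\to\wp(B)\setminus\{\emptyset\}$. A homomorphism $f:\mathcal{A}\to\mathcal{B}$ is a function between the domains with $f[c^{\mathcal{A}}(\vec a)]\subseteq c^{\mathcal{B}}(f(\vec a))$ for all $c$ and $\vec a$. These form the category $\mathbf{MAlg}(\Sigma)$; a monomorphism of multialgebras is a monomorphism in this category. The product $\prod_{i\in I}\mathcal{A}_i$ has as domain the cartesian product of the domains and multioperations $c(\vec a)=\prod_{i\in I}c^{\mathcal{A}_i}(\pi_i(\vec a))$ (for $I=\emptyset$ it is the one-element multialgebra). For a Boolean algebra $\mathcal{A}$ with domain $A$ (the one-element Boolean algebra is allowed) and $z\in A^3$ write $z=(z_1,z_2,z_3)$; $\sim$ is Boolean complement. Put $\mathrm{B}_{\mathcal{A}}^{\mathbf{ciw}}=\{z\in A^3 : z_1\vee z_2=1 \text{ and } z_3={\sim}(z_1\wedge z_2)\}$. A swap structure for $\mathbf{mbCciw}$ over $\mathcal{A}$ is a multialgebra $\mathcal{B}$ over $\Sigma$ with domain $B\subseteq \mathrm{B}_{\mathcal{A}}^{\mathbf{ciw}}$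 such that $0\in\{z_1: z\in B\}$ and for all $z,w\in B$: (i) $\emptyset\ne z\#w\subseteq\{u\in B: u_1=z_1\# w_1\}$ for $\#\in\{\wedge,\vee,\to\}$; (ii) $\emptyset\neq\neg z\subseteq\{u\in B:u_1=z_2\}$; (iii) $\emptyset\ne\circ z\subseteq\{u\in B:u_1=z_3\}$. A swap structure for $\mathbf{mbCciw}$ is one over some Boolean algebra. The full swap structure $\mathcal{B}_{\mathcal{A}}^{\mathbf{mbCciw}}$ has domain $\mathrm{B}_{\mathcal{A}}^{\mathbf{ciw}}$ and equality in the right-hand inclusions of (i)–(iii). $\mathbb{A}_2$ is the two-element Boolean algebra. -}

module Defs where

open import Level using (Level; Setω; suc; _⊔_)
open import Algebra.Lattice.Bundles using (BooleanAlgebra)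
open import Data.Bool.Properties using (∨-∧-booleanAlgebra)
open import Data.Nat.Base using (ℕ)
open import Data.Product.Base using (Σ; ∃; _×_; _,_; proj₁; proj₂)
open import Data.Product.Relation.Binary.Pointwise.NonDependent using (×-setoid)
open import Data.Vec.Base using (Vec; []; _∷_; map)
open import Data.Vec.Relation.Binary.Pointwise.Inductive as Pointwise
  using (Pointwise; []; _∷_)
open import Function.Bundles using (Func)
open import Relation.Binary.Bundles using (Setoid)
import Relation.Binary.Construct.On as On

-- Zermelo's axiom of choice.  The type-theoretic choice principle is provable
-- outright; the set-theoretic axiom is the one whose choice function respects
-- the equality of the setoid X.  By Diaconescu's argument it yields excluded
-- middle, so it stands for the classical set theory (with choice) in which the
-- mathematics is carried out.

AxiomOfChoice : Setω
AxiomOfChoice =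
  ∀ {a e b f r : Level} (X : Setoid a e) (Y : Setoid b f) →
  let module X = Setoid X
      module Y = Setoid Y
  in
  (R : X.Carrier → Y.Carrier → Set r) →
  (∀ {x x′ y y′} → x X.≈ x′ → y Y.≈ y′ → R x y → R x′ y′) →
  (∀ x → ∃ λ y → R x y) →
  Σ (Func X Y) λ φ → ∀ x → R x (Func.to φ x)

data Symbol : Set where
  and or imp neg circ : Symbol

arity : Symbol → ℕ
arity and  = 2
arity or   = 2
arity imp  = 2
arity neg  = 1
arity circ = 1

-- Sets are setoids and subsets are predicates respecting the setoid equality.
-- `op c as u` reads u ∈ c(as).

record MultiOperations {a e} (S : Setoid a e) (o : Level) :
                       Set (a ⊔ e ⊔ suc o) where
  open Setoid S
  field
    op          : (c : Symbol) → Vec Carrier (arity c) → Carrier → Set o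
    op-resp     : ∀ c {as bs u v} → Pointwise _≈_ as bs → u ≈ v →
                  op c as u → op c bs v
    op-nonempty : ∀ c as → ∃ λ u → op c as u

record MultiAlgebra (ℓ : Level) : Set (suc ℓ) where
  field
    setoid     : Setoid ℓ ℓ
    inhabitant : Setoid.Carrier setoid
    operations : MultiOperations setoid ℓ
  open Setoid setoid public using (Carrier; _≈_)
  open MultiOperations operations public

record Hom {ℓ₁ ℓ₂} (A : MultiAlgebra ℓ₁) (B : MultiAlgebra ℓ₂) :
           Set (ℓ₁ ⊔ ℓ₂) where
  private
    module A = MultiAlgebra A
    module B = MultiAlgebra B
  field
    func     : Func A.setoid B.setoid
  open Func func public using (to; cong)
  field
    preserve : ∀ c as {u} → A.op c as u → B.op c (map to as) (to u)

-- Monomorphisms of the category of multialgebras whose underlying sets are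
-- ℓ-small; parallel morphisms are equal when they are pointwise equal.

IsMonomorphism : ∀ {ℓ} {A B : MultiAlgebra ℓ} → Hom A B → Set (suc ℓ)
IsMonomorphism {ℓ} {A} {B} f =
  (C : MultiAlgebra ℓ) (g h : Hom C A) →
  (∀ x → Hom.to f (Hom.to g x) B.≈ Hom.to f (Hom.to h x)) →
  ∀ x → Hom.to g x A.≈ Hom.to h x
  where
  module A = MultiAlgebra A
  module B = MultiAlgebra B

∏ : ∀ {i ℓ} (I : Set i) → (I → MultiAlgebra ℓ) → MultiAlgebra (i ⊔ ℓ)
∏ I A = record
  { setoid = record
    { Carrier       = ∀ i → A.Carrier i
    ; _≈_           = λ f g → ∀ i → A._≈_ i (f i) (g i)
    ; isEquivalence = record
      { refl  = λ i → S.refl i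
      ; sym   = λ p i → S.sym i (p i)
      ; trans = λ p q i → S.trans i (p i) (q i)
      }
    }
  ; inhabitant = λ i → A.inhabitant i
  ; operations = record
    { op          = λ c fs u → ∀ i → A.op i c (map (λ f → f i) fs) (u i)
    ; op-resp     = λ c ps q r i →
                    A.op-resp i c (Pointwise.map⁺ (λ p → p i) ps) (q i) (r i)
    ; op-nonempty = λ c fs →
                    (λ i → proj₁ (A.op-nonempty i c (map (λ f → f i) fs))) ,
                    (λ i → proj₂ (A.op-nonempty i c (map (λ f → f i) fs)))
    }
  }
  where
  module A i = MultiAlgebra (A i)
  module S i = Setoid (A.setoid i)

module _ {ℓ} (𝓐 : BooleanAlgebra ℓ ℓ) where

  open BooleanAlgebra 𝓐

  Triple : Setoid ℓ ℓ
  Triple = ×-setoid setoid (×-setoid setoid setoid)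

  private
    A³ : Set ℓ
    A³ = Setoid.Carrier Triple

    _≈³_ : A³ → A³ → Set ℓ
    _≈³_ = Setoid._≈_ Triple

  Bciw : A³ → Set ℓ
  Bciw (z₁ , z₂ , z₃) = (z₁ ∨ z₂ ≈ ⊤) × (z₃ ≈ ¬ (z₁ ∧ z₂))

  SubTriple : (A³ → Set ℓ) → Setoid ℓ ℓ
  SubTriple D = On.setoid {B = ∃ D} Triple proj₁

  -- The first coordinate that every element of c(zs) must have.

  first : (c : Symbol) → Vec A³ (arity c) → Carrier
  first and  ((z₁ , _) ∷ (w₁ , _) ∷ []) = z₁ ∧ w₁
  first or   ((z₁ , _) ∷ (w₁ , _) ∷ []) = z₁ ∨ w₁
  first imp  ((z₁ , _) ∷ (w₁ , _) ∷ []) = ¬ z₁ ∨ w₁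
  first neg  ((_ , z₂ , _) ∷ [])        = z₂
  first circ ((_ , _ , z₃) ∷ [])        = z₃

  record SwapStructure : Set (suc ℓ) where
    field
      Domain      : A³ → Set ℓ
      Domain-resp : ∀ {z w} → z ≈³ w → Domain z → Domain w
      Domain⊆Bciw : ∀ {z} → Domain z → Bciw z
      zero∈Domain : ∃ λ z → Domain z × proj₁ z ≈ ⊥
      operations  : MultiOperations (SubTriple Domain) ℓ
    open MultiOperations operations
    field
      op⊆first    : ∀ c zs {u} → op c zs u →
                    proj₁ (proj₁ u) ≈ first c (map proj₁ zs)

    multiAlgebra : MultiAlgebra ℓ
    multiAlgebra = record
      { setoid     = SubTriple Domain
      ; inhabitant = proj₁ zero∈Domain , proj₁ (proj₂ zero∈Domain)
      ; operations = operations
      }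

  private
    Bciw-resp : ∀ {z w} → z ≈³ w → Bciw z → Bciw w
    Bciw-resp (p₁ , p₂ , p₃) (q , r) =
      trans (sym (∨-cong p₁ p₂)) q ,
      trans (sym p₃) (trans r (¬-cong (∧-cong p₁ p₂)))

    lift₁ : Carrier → ∃ Bciw
    lift₁ a = (a , ¬ a , ¬ (a ∧ ¬ a)) , proj₂ ∨-complement a , refl

    first-cong : ∀ c {zs ws : Vec (∃ Bciw) (arity c)} →
                 Pointwise (λ z w → proj₁ z ≈³ proj₁ w) zs ws →
                 first c (map proj₁ zs) ≈ first c (map proj₁ ws)
    first-cong and  ((p , _) ∷ (q , _) ∷ []) = ∧-cong p q
    first-cong or   ((p , _) ∷ (q , _) ∷ []) = ∨-cong p q
    first-cong imp  ((p , _) ∷ (q , _) ∷ []) = ∨-cong (¬-cong p) q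
    first-cong neg  ((_ , p , _) ∷ [])       = p
    first-cong circ ((_ , _ , p) ∷ [])       = p

  fullSwapStructure : SwapStructure
  fullSwapStructure = record
    { Domain      = Bciw
    ; Domain-resp = Bciw-resp
    ; Domain⊆Bciw = λ z∈ → z∈
    ; zero∈Domain = proj₁ (lift₁ ⊥) , proj₂ (lift₁ ⊥) , refl
    ; operations  = record
      { op          = λ c zs u → proj₁ (proj₁ u) ≈ first c (map proj₁ zs)
      ; op-resp     = λ c ps q r →
                      trans (sym (proj₁ q)) (trans r (first-cong c ps))
      ; op-nonempty = λ c zs → lift₁ (first c (map proj₁ zs)) , refl
      }
    ; op⊆first    = λ c zs r → r
    }

𝔸₂ : BooleanAlgebra Level.zero Level.zero
𝔸₂ = ∨-∧-booleanAlgebra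

𝓑𝔸₂ : MultiAlgebra Level.zero
𝓑𝔸₂ = SwapStructure.multiAlgebra (fullSwapStructure 𝔸₂)

{-# OPTIONS --safe #-}

-- A Boolean algebra has enough two-valued homomorphisms h to separate its
-- points, and each of them, applied to the three coordinates, maps a swap
-- structure to 𝓑𝔸₂.  The separation is the ultrafilter theorem, obtained from
-- choice: Diaconescu's argument gives excluded middle, so that subsets may be
-- taken to be Bool-valued and no universe level increases, and a maximal
-- consistent set is the top of the tower generated by unions and by the
-- adjunction of chosen elements.

module Submission where

open import Defs
open import Algebra.Lattice.Bundles using (BooleanAlgebra)
import Algebra.Lattice.Properties.BooleanAlgebra as BooleanAlgebraProperties
open import Data.Bool.Base using (Bool; true; false; T; not; _∧_; _∨_)
open import Data.Bool.Properties
  using (T?; T-≡; ¬-not; not-involutive; ∧-inverseʳ; ∨-inverseʳ)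
open import Data.Empty using (⊥-elim)
open import Data.Product.Base using (Σ; ∃; _×_; _,_; proj₁; proj₂)
open import Data.Sum.Base using (_⊎_; inj₁; inj₂; [_,_]′)
open import Data.Unit.Base using (tt)
open import Data.Vec.Base using ([]; _∷_; map)
open import Function.Base using (id; _∘_)
open import Function.Bundles using (Func; Equivalence)
open import Level using (Level)
open import Relation.Binary.Bundles using (Setoid)
open import Relation.Binary.PropositionalEquality
  using (_≡_; refl; sym; trans; cong; cong₂; subst; setoid; _→-setoid_;
         module ≡-Reasoning)
import Relation.Binary.Reasoning.Setoid as SetoidReasoning
open import Relation.Nullary using (Dec; yes; no; ¬_; contradiction)
open import Relation.Nullary.Decidable
  using (⌊_⌋; map′; toWitness; fromWitness; decidable-stable)

-- Excluded middle from choice.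

excludedMiddle : AxiomOfChoice → ∀ {p} (P : Set p) → Dec P
excludedMiddle ac {p} P = decide (R-choose true) (R-choose false)
  where
  -- The two points are identified exactly when `P` holds. Respectful representatives then coincide
  -- if `P` holds, so if both points represent themselves, `P` fails.
  _~_ : Bool → Bool → Set p
  x ~ y = x ≡ y ⊎ P

  ~-sym : ∀ {x y} → x ~ y → y ~ x
  ~-sym (inj₁ q) = inj₁ (sym q)
  ~-sym (inj₂ q) = inj₂ q

  ~-trans : ∀ {x y z} → x ~ y → y ~ z → x ~ z
  ~-trans (inj₁ q) (inj₁ r) = inj₁ (trans q r)
  ~-trans (inj₁ _) (inj₂ r) = inj₂ r
  ~-trans (inj₂ q) _        = inj₂ q

  Bool/P : Setoid _ p
  Bool/P = record
    { Carrier       = Bool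
    ; _≈_           = _~_
    ; isEquivalence = record { refl = inj₁ refl ; sym = ~-sym ; trans = ~-trans }
    }

  representative = ac Bool/P (setoid Bool) _~_
    (λ { q refl r → ~-trans (~-sym q) r }) (λ x → x , inj₁ refl)

  open Func (proj₁ representative) renaming (to to choose; cong to choose-cong)

  R-choose : ∀ x → x ~ choose x
  R-choose = proj₂ representative

  decide : true ~ choose true → false ~ choose false → Dec P
  decide (inj₂ q) _        = yes q
  decide (inj₁ _) (inj₂ r) = yes r
  decide (inj₁ q) (inj₁ r) = no λ p →
    contradiction (trans q (trans (choose-cong (inj₂ p)) (sym r))) λ ()

-- Bool-valued subsets.

Subset : ∀ {a} → Set a → Set a
Subset A = A → Bool

module _ {a} {A : Set a} where

  infix 4 _∈_ _⊆_

  -- A record rather than T (F x), so that x and F can be inferred from x ∈ F.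
  record _∈_ (x : A) (F : Subset A) : Set where
    constructor member
    field holds : T (F x)

  open _∈_ public

  _∈?_ : ∀ x F → Dec (x ∈ F)
  x ∈? F = map′ member holds (T? (F x))

  _⊆_ : Subset A → Subset A → Set a
  F ⊆ G = ∀ {x} → x ∈ F → x ∈ G

IsChain : ∀ {a} {A : Set a} → Subset (Subset A) → Set a
IsChain C = ∀ {F G} → F ∈ C → G ∈ C → F ⊆ G ⊎ G ⊆ F

-- Pointwise equality is the equality of `A →-setoid Bool`, which a choice function on subsets
-- respects.
⊆-antisym : ∀ {a} {A : Set a} {F G : Subset A} → F ⊆ G → G ⊆ F → ∀ x → F x ≡ G x
⊆-antisym {F = F} {G} F⊆G G⊆F x with F x in Fx | G x in Gx
... | false | false = refl
... | true  | true  = refl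
... | true  | false = ⊥-elim (subst T Gx (holds (F⊆G (member (subst T (sym Fx) tt)))))
... | false | true  = ⊥-elim (subst T Fx (holds (G⊆F (member (subst T (sym Gx) tt)))))

≗⇒⊆ : ∀ {a} {A : Set a} {F G : Subset A} → (∀ x → F x ≡ G x) → F ⊆ G
≗⇒⊆ F≗G {x} (member x∈F) = member (subst T (F≗G x) x∈F)

-- Comprehension and towers of subsets.

module WithChoice (ac : AxiomOfChoice) where

  lem : ∀ {p} (P : Set p) → Dec P
  lem = excludedMiddle ac

  module _ {a p : Level} {A : Set a} where

    -- Abstract, since otherwise P cannot be inferred from x ∈ ｛ P ｝.
    abstract

      ｛_｝ : (A → Set p) → Subset A
      ｛ P ｝ x = ⌊ lem (P x) ⌋

      ∈⁺ : ∀ {P x} → P x → x ∈ ｛ P ｝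
      ∈⁺ p = member (fromWitness p)

      ∈⁻ : ∀ {P x} → x ∈ ｛ P ｝ → P x
      ∈⁻ (member x∈) = toWitness x∈

  module _ {a} {A : Set a} where

    insert : Subset A → A → Subset A
    insert F x = ｛ (λ y → y ∈ F ⊎ y ≡ x) ｝

    ⋃ : Subset (Subset A) → Subset A
    ⋃ C = ｛ (λ x → ∃ λ F → F ∈ C × x ∈ F) ｝

    insert-mono : ∀ {F G : Subset A} {x} → F ⊆ G → insert F x ⊆ insert G x
    insert-mono F⊆G = ∈⁺ ∘ [ inj₁ ∘ F⊆G , inj₂ ]′ ∘ ∈⁻

    ⋃-upper : ∀ {C F} → F ∈ C → F ⊆ ⋃ C
    ⋃-upper F∈C x∈F = ∈⁺ (_ , F∈C , x∈F)

    ⋃-least : ∀ {C} {G : Subset A} → (∀ {F} → F ∈ C → F ⊆ G) → ⋃ C ⊆ G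
    ⋃-least upper x∈⋃ with F , F∈C , x∈F ← ∈⁻ x∈⋃ =
      upper F∈C x∈F

    -- Subsets included in each other need not be identical as functions, so `next` is assumed to
    -- respect mutual inclusion.
    module Tower
      (next : Subset A → Subset A)
      (next-inflationary : ∀ {F} → F ⊆ next F)
      (next-cong : ∀ {F G} → F ⊆ G → G ⊆ F → next F ⊆ next G)
      where

      -- Unions are taken over arbitrary families of stages, the empty one giving the empty stage;
      -- that stages form a chain is proved afterwards.
      data Stage : Subset A → Set a where
        successor : ∀ {F} → Stage F → Stage (next F)
        union     : ∀ C → (∀ {F} → F ∈ C → Stage F) → Stage (⋃ C)

      -- Comparability of stages follows Bourbaki and Witt: extreme stages are
      -- comparable to all stages, and every stage is extreme.
      Extreme : Subset A → Set a
      Extreme F = ∀ {G} → Stage G → G ⊆ F → ¬ F ⊆ G → next G ⊆ F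

      -- Induction on `G`. Below `F`, a successor step either starts from `F` itself and reaches
      -- `next F`, or starts properly below and stays inside `F` by extremeness. A union contains
      -- `next F` if some member does; otherwise all members lie in `F`.
      extreme⇒comparable : ∀ {F G} → Extreme F → Stage G → G ⊆ F ⊎ next F ⊆ G
      extreme⇒comparable {F} ext (successor {G} g) with extreme⇒comparable ext g
      ... | inj₂ nF⊆G = inj₂ (next-inflationary ∘ nF⊆G)
      ... | inj₁ G⊆F with lem (F ⊆ G)
      ...   | yes F⊆G = inj₂ (next-cong F⊆G G⊆F)
      ...   | no  F⊈G = inj₁ (ext g G⊆F F⊈G)
      extreme⇒comparable {F} ext (union C c)
        with lem (∃ λ G → G ∈ C × next F ⊆ G)
      ... | yes (G , G∈C , nF⊆G) = inj₂ (⋃-upper G∈C ∘ nF⊆G)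
      ... | no  ∄ = inj₁ (⋃-least λ G∈C →
        [ id , (λ nF⊆G → contradiction (_ , G∈C , nF⊆G) ∄) ]′
          (extreme⇒comparable ext (c G∈C)))

      extreme : ∀ {F} → Stage F → Extreme F
      extreme (successor {F} f) {G} g G⊆nF nF⊈G
        with extreme⇒comparable (extreme f) g
      ... | inj₂ nF⊆G = ⊥-elim (nF⊈G nF⊆G)
      ... | inj₁ G⊆F with lem (F ⊆ G)
      ...   | yes F⊆G = next-cong G⊆F F⊆G
      ...   | no  F⊈G = next-inflationary ∘ extreme f g G⊆F F⊈G
      extreme (union C c) {G} g G⊆⋃ ⋃⊈G
        -- A union not contained in `G` has a member not contained in `G`, and the extremeness of
        -- that member applies.
        with lem (∃ λ F → F ∈ C × ¬ F ⊆ G)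
      ... | no ∄ = ⊥-elim (⋃⊈G (⋃-least λ F∈C x∈F →
        decidable-stable (_ ∈? _) λ x∉G → ∄ (_ , F∈C , λ F⊆G → x∉G (F⊆G x∈F))))
      ... | yes (F , F∈C , F⊈G) with extreme⇒comparable (extreme (c F∈C)) g
      ...   | inj₁ G⊆F  = ⋃-upper F∈C ∘ extreme (c F∈C) g G⊆F F⊈G
      ...   | inj₂ nF⊆G = ⊥-elim (F⊈G (nF⊆G ∘ next-inflationary))

      comparable : ∀ {F G} → Stage F → Stage G → F ⊆ G ⊎ G ⊆ F
      comparable f g with extreme⇒comparable (extreme f) g
      ... | inj₁ G⊆F  = inj₂ G⊆F
      ... | inj₂ nF⊆G = inj₁ (nF⊆G ∘ next-inflationary)

      stages : Subset (Subset A)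
      stages = ｛ Stage ｝

      top-stage : Stage (⋃ stages)
      top-stage = union stages ∈⁻

      -- The successor of the top is itself a stage, hence a member of the family whose union is the
      -- top.
      top-fixed : next (⋃ stages) ⊆ ⋃ stages
      top-fixed = ⋃-upper (∈⁺ (successor top-stage))

  -- Maximal consistent sets.

  module _ {a} {A : Set a} (x₀ : A)
    (Con : Subset A → Set a)
    (Con-antitone : ∀ {F G} → F ⊆ G → Con G → Con F)
    (Con-⋃ : ∀ {C} → IsChain C → (∀ {F} → F ∈ C → Con F) → Con (⋃ C))
    where

    private
      Extends : Subset A → A → Set a
      Extends F x = ¬ x ∈ F × Con (insert F x)

      Extends-resp : ∀ {F G x} → (∀ x → F x ≡ G x) → Extends F x → Extends G x
      Extends-resp {F} {G} F≗G (x∉F , con) =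
        x∉F ∘ ≗⇒⊆ G≗F , Con-antitone (insert-mono (≗⇒⊆ G≗F)) con
        where
        G≗F : ∀ x → G x ≡ F x
        G≗F x = sym (F≗G x)

      -- The implication makes the relation total: where no proper consistent extension exists, any
      -- value will do and `x₀` is the default.
      extender = ac (A →-setoid Bool) (setoid A)
        (λ F x → ∃ (Extends F) → Extends F x)
        (λ { F≗G refl r (y , e) →
             Extends-resp F≗G (r (y , Extends-resp (sym ∘ F≗G) e)) })
        choose
        where
        choose : ∀ F → ∃ λ x → ∃ (Extends F) → Extends F x
        choose F with lem (∃ (Extends F))
        ... | yes (x , e) = x , λ _ → e
        ... | no  ∄       = x₀ , λ e → contradiction e ∄

      open Func (proj₁ extender) renaming (to to φ; cong to φ-cong)

      -- The consistency guard blocks a meaningless default value. As a condition on `y` it lets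
      -- `next` be defined without deciding a case.
      Added : Subset A → A → Set a
      Added F y = y ∈ F ⊎ (y ≡ φ F × Con (insert F (φ F)))

      next : Subset A → Subset A
      next F = ｛ Added F ｝

      next-cong : ∀ {F G} → F ⊆ G → G ⊆ F → next F ⊆ next G
      next-cong {F} {G} F⊆G G⊆F {y} y∈ with ∈⁻ y∈
      ... | inj₁ y∈F = ∈⁺ (inj₁ (F⊆G y∈F))
      ... | inj₂ (y≡ , con) = ∈⁺ (inj₂ (trans y≡ φF≡φG ,
        Con-antitone (insert-mono G⊆F) (subst (Con ∘ insert F) φF≡φG con)))
        where
        φF≡φG : φ F ≡ φ G
        φF≡φG = φ-cong (⊆-antisym F⊆G G⊆F)

      open Tower next (∈⁺ ∘ inj₁) next-cong

      -- The empty chain starts the induction. A successor lies inside `insert F (φ F)` if that is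
      -- consistent, and inside `F` otherwise.
      stage-Con : ∀ {F} → Stage F → Con F
      stage-Con (union C c) =
        Con-⋃ (λ F∈C G∈C → comparable (c F∈C) (c G∈C)) (λ F∈C → stage-Con (c F∈C))
      stage-Con (successor {F} f) with lem (Con (insert F (φ F)))
      ... | yes con  = Con-antitone
        (∈⁺ ∘ [ inj₁ , inj₂ ∘ proj₁ ]′ ∘ ∈⁻) con
      ... | no  ¬con = Con-antitone
        ([ id , (λ q → contradiction (proj₂ q) ¬con) ]′
               ∘ ∈⁻) (stage-Con f)

    tukey : ∃ λ U → Con U × (∀ {x} → Con (insert U x) → x ∈ U)
    tukey = U , stage-Con top-stage , maximal
      where
      U = ⋃ stages

      -- A missing `x` would make `φ U` a consistent element outside `U`, but `next U ⊆ U` puts it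
      -- inside.
      maximal : ∀ {x} → Con (insert U x) → x ∈ U
      maximal con = decidable-stable (_ ∈? _) λ x∉U →
        let φU∉U , con′ = proj₂ extender U (_ , x∉U , con)
        in φU∉U (top-fixed (∈⁺ (inj₂ (refl , con′))))

-- The ultrafilter theorem for Boolean algebras.

module Ultrafilter (ac : AxiomOfChoice) {ℓ} (𝓐 : BooleanAlgebra ℓ ℓ) where

  open WithChoice ac
  open BooleanAlgebra 𝓐 using (Carrier; _≈_; ⊤; ⊥; ∧-comm; ∧-assoc; ∧-congˡ; ∧-congʳ;
    ∨-comm; ∨-congˡ; ¬-cong; ∧-absorbs-∨; ∧-distribˡ-∨; ∨-distribˡ-∧;
    ∨-complementˡ; ∨-complementʳ; ∧-complementʳ)
    renaming (_∧_ to _⊓_; _∨_ to _⊔_; ¬_ to ∼_)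
  private
    module 𝓐 = BooleanAlgebra 𝓐
    module 𝔹 = BooleanAlgebraProperties 𝔸₂
  open BooleanAlgebraProperties 𝓐
    using (∧-idem; ∧-identityʳ; ∨-identityʳ; ∧-zeroʳ; ¬-involutive; deMorgan₂)

  record IsValuation (h : Carrier → Bool) : Set ℓ where
    field
      resp  : ∀ {x y} → x ≈ y → h x ≡ h y
      ∧-hom : ∀ x y → h (x ⊓ y) ≡ h x ∧ h y
      ¬-hom : ∀ x → h (∼ x) ≡ not (h x)

    ∨-hom : ∀ x y → h (x ⊔ y) ≡ h x ∨ h y
    ∨-hom x y = begin
      h (x ⊔ y)                   ≡⟨ resp (¬-involutive (x ⊔ y)) ⟨
      h (∼ ∼ (x ⊔ y))             ≡⟨ resp (¬-cong (deMorgan₂ x y)) ⟩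
      h (∼ (∼ x ⊓ ∼ y))           ≡⟨ ¬-hom _ ⟩
      not (h (∼ x ⊓ ∼ y))         ≡⟨ cong not (∧-hom _ _) ⟩
      not (h (∼ x) ∧ h (∼ y))     ≡⟨ cong₂ (λ b c → not (b ∧ c)) (¬-hom x) (¬-hom y) ⟩
      not (not (h x) ∧ not (h y)) ≡⟨ cong not (𝔹.deMorgan₂ (h x) (h y)) ⟨
      not (not (h x ∨ h y))       ≡⟨ not-involutive _ ⟩
      h x ∨ h y                   ∎
      where open ≡-Reasoning

    ⊤-hom : h ⊤ ≡ true
    ⊤-hom = trans (resp (𝓐.sym (∨-complementʳ ⊤)))
      (trans (∨-hom ⊤ (∼ ⊤)) (trans (cong (h ⊤ ∨_) (¬-hom ⊤)) (∨-inverseʳ (h ⊤))))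

  open SetoidReasoning 𝓐.setoid

  -- The filter generated by F and a; x ⊓ y ≈ x stands for x ≤ y.
  data Generated (a : Carrier) (F : Subset Carrier) : Carrier → Set ℓ where
    generator : Generated a F a
    member′   : ∀ {x} → x ∈ F → Generated a F x
    meet      : ∀ {x y} → Generated a F x → Generated a F y → Generated a F (x ⊓ y)
    upper     : ∀ {x y} → x ⊓ y ≈ x → Generated a F x → Generated a F y

  module _ {a : Carrier} where

    Generated-resp : ∀ {F x y} → x ≈ y → Generated a F x → Generated a F y
    Generated-resp x≈y =
      upper (𝓐.trans (∧-congˡ (𝓐.sym x≈y)) (∧-idem _))

    Generated-mono : ∀ {F G x} → F ⊆ G → Generated a F x → Generated a G x
    Generated-mono F⊆G generator   = generator
    Generated-mono F⊆G (member′ m) = member′ (F⊆G m)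
    Generated-mono F⊆G (meet g h)  = meet (Generated-mono F⊆G g) (Generated-mono F⊆G h)
    Generated-mono F⊆G (upper l g) = upper l (Generated-mono F⊆G g)

    -- A derivation uses finitely many members of the union, and some link of the chain contains
    -- them all. If it uses none, it only shows that `x` lies above `a`; this alternative covers the
    -- empty chain.
    Generated-⋃ : ∀ {C x} → IsChain C → Generated a (⋃ C) x →
      a ⊓ x ≈ a ⊎ (∃ λ F → F ∈ C × Generated a F x)
    Generated-⋃ chain generator = inj₁ (∧-idem a)
    Generated-⋃ chain (member′ m) with F , F∈C , x∈F ← ∈⁻ m =
      inj₂ (F , F∈C , member′ x∈F)
    Generated-⋃ chain (upper {x} {y} x≤y g) with Generated-⋃ chain g
    ... | inj₂ (F , F∈C , p) = inj₂ (F , F∈C , upper x≤y p)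
    ... | inj₁ a≤x           = inj₁ (begin
      a ⊓ y        ≈⟨ ∧-congʳ a≤x ⟨
      (a ⊓ x) ⊓ y  ≈⟨ ∧-assoc a x y ⟩
      a ⊓ (x ⊓ y)  ≈⟨ ∧-congˡ x≤y ⟩
      a ⊓ x        ≈⟨ a≤x ⟩
      a            ∎)
    Generated-⋃ chain (meet {x} {y} g h) with Generated-⋃ chain g | Generated-⋃ chain h
    ... | inj₁ a≤x           | inj₁ a≤y           = inj₁ (begin
      a ⊓ (x ⊓ y)  ≈⟨ ∧-assoc a x y ⟨
      (a ⊓ x) ⊓ y  ≈⟨ ∧-congʳ a≤x ⟩
      a ⊓ y        ≈⟨ a≤y ⟩
      a            ∎)
    ... | inj₁ a≤x           | inj₂ (G , G∈C , q) =
      inj₂ (G , G∈C , meet (upper a≤x generator) q)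
    ... | inj₂ (F , F∈C , p) | inj₁ a≤y           =
      inj₂ (F , F∈C , meet p (upper a≤y generator))
    ... | inj₂ (F , F∈C , p) | inj₂ (G , G∈C , q) with chain F∈C G∈C
    ...   | inj₁ F⊆G = inj₂ (G , G∈C , meet (Generated-mono F⊆G p) q)
    ...   | inj₂ G⊆F = inj₂ (F , F∈C , meet p (Generated-mono G⊆F q))

    Generated-⊤ : ∀ {F} → Generated a F ⊤
    Generated-⊤ = upper (∧-identityʳ a) generator

    weaken : ∀ {F x y} → Generated a F y → Generated a F (∼ x ⊔ y)
    weaken = upper (𝓐.trans (∧-congˡ (∨-comm _ _)) (∧-absorbs-∨ _ _))

    -- The deduction theorem, with `∼ x ⊔ y` as implication; distributivity carries it through
    -- `meet` and `upper`.
    deduction : ∀ {F x y} → Generated a (insert F x) y → Generated a F (∼ x ⊔ y)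
    deduction generator = weaken generator
    deduction (member′ m) with ∈⁻ m
    ... | inj₁ y∈F  = weaken (member′ y∈F)
    ... | inj₂ refl = Generated-resp (𝓐.sym (∨-complementˡ _)) Generated-⊤
    deduction {x = x} (meet {y} {z} g h) =
      Generated-resp (𝓐.sym (∨-distribˡ-∧ (∼ x) y z)) (meet (deduction g) (deduction h))
    deduction {x = x} (upper {y} {z} y≤z g) =
      upper (𝓐.trans (𝓐.sym (∨-distribˡ-∧ (∼ x) y z)) (∨-congˡ y≤z)) (deduction g)

    Consistent : Subset Carrier → Set ℓ
    Consistent F = ¬ Generated a F ⊥

    refute : ∀ {F x} → ¬ Consistent (insert F x) → Generated a F (∼ x)
    refute ¬con = Generated-resp (∨-identityʳ _)
      (deduction (decidable-stable (lem _) ¬con))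

  -- A maximal consistent set is an ultrafilter and, being Bool-valued, is already the homomorphism.
  -- Since `a` generates every filter considered, deductive closure puts it into `U`.
  valuation-at : ∀ {a} → ¬ a ≈ ⊥ → ∃ λ h → IsValuation h × h a ≡ true
  valuation-at {a} a≉⊥ = U , isValuation , ∈⇒true (closed generator)
    where
    Consistent-⋃ : ∀ {C} → IsChain C → (∀ {F} → F ∈ C → Consistent {a} F) →
                   Consistent {a} (⋃ C)
    Consistent-⋃ chain con g with Generated-⋃ chain g
    ... | inj₁ a≤⊥           = a≉⊥ (𝓐.trans (𝓐.sym a≤⊥) (∧-zeroʳ a))
    ... | inj₂ (F , F∈C , p) = con F∈C p

    maximalConsistent = tukey ⊤ (Consistent {a})
      (λ F⊆G con → con ∘ Generated-mono F⊆G) Consistent-⋃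

    U : Subset Carrier
    U = proj₁ maximalConsistent

    consistent : Consistent U
    consistent = proj₁ (proj₂ maximalConsistent)

    maximal : ∀ {x} → Consistent (insert U x) → x ∈ U
    maximal = proj₂ (proj₂ maximalConsistent)

    exclusive : ∀ {x} → Generated a U x → ¬ Generated a U (∼ x)
    exclusive g h = consistent (Generated-resp (∧-complementʳ _) (meet g h))

    -- If adding `x` were inconsistent, `U` would derive `∼ x` as well as `x`.
    closed : ∀ {x} → Generated a U x → x ∈ U
    closed g = maximal λ ⊥-derived → exclusive g (refute λ con → con ⊥-derived)

    ∉⇒∼∈ : ∀ {x} → ¬ x ∈ U → ∼ x ∈ U
    ∉⇒∼∈ x∉U = closed (refute (x∉U ∘ maximal))

    ∈⇒true : ∀ {x} → x ∈ U → U x ≡ true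
    ∈⇒true = Equivalence.to T-≡ ∘ holds

    ∉⇒false : ∀ {x} → ¬ x ∈ U → U x ≡ false
    ∉⇒false x∉U = ¬-not (x∉U ∘ member ∘ Equivalence.from T-≡)

    U-⇔ : ∀ {x y} → (x ∈ U → y ∈ U) → (y ∈ U → x ∈ U) → U x ≡ U y
    U-⇔ {x} x⇒y y⇒x with x ∈? U
    ... | yes x∈U = trans (∈⇒true x∈U) (sym (∈⇒true (x⇒y x∈U)))
    ... | no  x∉U = trans (∉⇒false x∉U) (sym (∉⇒false (x∉U ∘ y⇒x)))

    isValuation : IsValuation U
    isValuation = record
      { resp  = λ x≈y → U-⇔ (closed ∘ Generated-resp x≈y ∘ member′)
                            (closed ∘ Generated-resp (𝓐.sym x≈y) ∘ member′)
      ; ∧-hom = ∧-hom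
      ; ¬-hom = ¬-hom
      }
      where
      ⊓-lower₁ : ∀ {x y} → x ⊓ y ∈ U → x ∈ U
      ⊓-lower₁ {x} {y} = closed ∘ upper (begin
        (x ⊓ y) ⊓ x  ≈⟨ ∧-comm _ _ ⟩
        x ⊓ (x ⊓ y)  ≈⟨ ∧-assoc x x y ⟨
        (x ⊓ x) ⊓ y  ≈⟨ ∧-congʳ (∧-idem x) ⟩
        x ⊓ y        ∎) ∘ member′

      ⊓-lower₂ : ∀ {x y} → x ⊓ y ∈ U → y ∈ U
      ⊓-lower₂ {x} {y} = closed ∘ upper
        (𝓐.trans (∧-assoc x y y) (∧-congˡ (∧-idem y))) ∘ member′

      ∧-hom : ∀ x y → U (x ⊓ y) ≡ U x ∧ U y
      ∧-hom x y with x ∈? U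
      ... | no x∉U rewrite ∉⇒false x∉U = ∉⇒false (x∉U ∘ ⊓-lower₁)
      ... | yes x∈U rewrite ∈⇒true x∈U =
        U-⇔ ⊓-lower₂ (λ y∈U → closed (meet (member′ x∈U) (member′ y∈U)))

      ¬-hom : ∀ x → U (∼ x) ≡ not (U x)
      ¬-hom x with x ∈? U
      ... | no x∉U rewrite ∉⇒false x∉U = ∈⇒true (∉⇒∼∈ x∉U)
      ... | yes x∈U rewrite ∈⇒true x∈U =
        ∉⇒false (λ ∼x∈U → exclusive (member′ x∈U) (member′ ∼x∈U))

  Valuation : Set ℓ
  Valuation = ∃ IsValuation

  Indistinguishable : Carrier → Carrier → Set ℓ
  Indistinguishable x y = ((h , _) : Valuation) → h x ≡ h y

  -- If `x ⊓ ∼ y` were not `⊥`, some valuation would make it true and so separate `x` from `y`.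
  indistinguishable⇒≤ : ∀ {x y} → Indistinguishable x y → x ⊓ y ≈ x
  indistinguishable⇒≤ {x} {y} eq = begin
    x ⊓ y                ≈⟨ ∨-identityʳ _ ⟨
    (x ⊓ y) ⊔ ⊥          ≈⟨ ∨-congˡ x⊓∼y≈⊥ ⟨
    (x ⊓ y) ⊔ (x ⊓ ∼ y)  ≈⟨ ∧-distribˡ-∨ x y (∼ y) ⟨
    x ⊓ (y ⊔ ∼ y)        ≈⟨ ∧-congˡ (∨-complementʳ y) ⟩
    x ⊓ ⊤                ≈⟨ ∧-identityʳ x ⟩
    x                    ∎
    where
    x⊓∼y≈⊥ : x ⊓ ∼ y ≈ ⊥
    x⊓∼y≈⊥ = decidable-stable (lem _) λ ≉⊥ →
      let h , val , h≡true = valuation-at ≉⊥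
          open IsValuation val
          h≡false = trans (∧-hom x (∼ y)) (trans (cong₂ _∧_ (eq (h , val)) (¬-hom y))
                      (∧-inverseʳ (h y)))
      in contradiction (trans (sym h≡true) h≡false) λ ()

  indistinguishable⇒≈ : ∀ {x y} → Indistinguishable x y → x ≈ y
  indistinguishable⇒≈ {x} {y} eq = begin
    x      ≈⟨ indistinguishable⇒≤ eq ⟨
    x ⊓ y  ≈⟨ ∧-comm x y ⟩
    y ⊓ x  ≈⟨ indistinguishable⇒≤ (sym ∘ eq) ⟩
    y      ∎

-- Valuations as coordinates of the embedding.

module Representation (ac : AxiomOfChoice) {ℓ} (𝓐 : BooleanAlgebra ℓ ℓ)
  (𝓑 : SwapStructure 𝓐) where

  open Ultrafilter ac 𝓐
  open SwapStructure 𝓑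
  open IsValuation

  valuationHom : Hom multiAlgebra (∏ Valuation (λ _ → 𝓑𝔸₂))
  valuationHom = record
    { func = record
      { to   = λ { ((z₁ , z₂ , z₃) , z∈) (h , val) → (h z₁ , h z₂ , h z₃) ,
          let p , q = Domain⊆Bciw z∈ in
          trans (sym (∨-hom val z₁ z₂)) (trans (resp val p) (⊤-hom val)) ,
          trans (resp val q) (trans (¬-hom val _) (cong not (∧-hom val z₁ z₂))) }
      ; cong = λ { (p₁ , p₂ , p₃) (h , val) → resp val p₁ , resp val p₂ , resp val p₃ }
      }
    -- Membership in an operation of the full swap structure constrains only the first coordinate,
    -- which `op⊆first` determines in the source.
    ; preserve = λ c as u∈ (h , val) →
        trans (resp val (op⊆first c as u∈)) (first-hom val c as)
    }
    where
    first-hom : ∀ {h} (val : IsValuation h) c as → h (first 𝓐 c (map proj₁ as)) ≡ _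
    first-hom val and  (z ∷ w ∷ []) = ∧-hom val _ _
    first-hom val or   (z ∷ w ∷ []) = ∨-hom val _ _
    first-hom val imp  (z ∷ w ∷ []) = trans (∨-hom val _ _) (cong (_∨ _) (¬-hom val _))
    first-hom val neg  (z ∷ [])     = refl
    first-hom val circ (z ∷ [])     = refl

  valuationHom-injective : ∀ z w →
    MultiAlgebra._≈_ (∏ Valuation (λ _ → 𝓑𝔸₂))
      (Hom.to valuationHom z) (Hom.to valuationHom w) →
    MultiAlgebra._≈_ multiAlgebra z w
  valuationHom-injective _ _ eq =
    indistinguishable⇒≈ (proj₁ ∘ eq) ,
    indistinguishable⇒≈ (proj₁ ∘ proj₂ ∘ eq) ,
    indistinguishable⇒≈ (proj₂ ∘ proj₂ ∘ eq)

theorem8p20 : AxiomOfChoice →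
    ∀ {ℓ} (𝓐 : BooleanAlgebra ℓ ℓ) (𝓑 : SwapStructure 𝓐) →
    Σ (Set ℓ) λ I →
    Σ (Hom (SwapStructure.multiAlgebra 𝓑) (∏ I (λ _ → 𝓑𝔸₂))) λ ĥ →
    IsMonomorphism ĥ
-- Injectivity gives left cancellation. The one-element algebra has no valuations, and the product
-- is then the one-element multialgebra.
theorem8p20 ac 𝓐 𝓑 = Valuation , valuationHom ,
  λ _ g h eq x → valuationHom-injective (Hom.to g x) (Hom.to h x) (eq x)
  where
  open Ultrafilter ac 𝓐 using (Valuation)
  open Representation ac 𝓐 𝓑
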